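{- Let $G_1$ and $G_2$ be two groups and let $\mathcal{F}$ and $\mathcal{G}$ be filters on $G_1$ and $G_2$ respectively such that $\overline{\mathcal{F}}$ and $\overline{\mathcal{G}}$ are subsemigroups of $\beta G_1$ and $\beta G_2$ respectively. Let $\varphi:G_1\to G_2$ be an $(\mathcal{F},\mathcal{G})$-good homomorphism such that $\varphi(G_1)$ is piecewise $\mathcal{G}$-syndetic. Then for every piecewise $\mathcal{F}$-syndetic subgroup $H_1$ of $G_1$, the set $\varphi(H_1)$ is piecewise $\mathcal{G}$-syndetic.
   Context: For a discrete group (or semigroup) $S$, $\beta S$ is the set of ultrafilters on $S$ with basic open sets $\bar A=\{p\in\beta S: A\in p\}$ and operation: $A\in p\cdot q$ iff $\{x\in S: x^{ -1}A\in q\}\in p$, where $x^{ -1}A=\{y\in S: xy\in A\}$. For a filter $\mathcal{F}$ on $S$, $\overline{\mathcal{F}}=\bigcap_{V\in\mathcal{F}}\bar V$ is the closed set of ultrafilters containing $\mathcal{F}$; when it is a semigroup, $K(\overline{\mathcal{F}})$ denotes its smallest two-sided ideal. A set $A\subseteq S$ is piecewise $\mathcal{F}$-syndetic if $\bar A\cap K(\overline{\mathcal{F}})\neq\emptyset$. A group homomorphism $\varphi:G_1\to G_2$ is $(\mathcal{F},\mathcal{G})$-good if for every $F\in\mathcal{F}$ there exists $G\in\mathcal{G}$ with $F=\varphi^{ -1}(G)=\{x\in G_1:\varphi(x)\in G\}$. -}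

module Defs where

open import Algebra.Bundles using (Group)
open import Algebra.Morphism.Structures using (module GroupMorphisms)
open import Data.Empty.Polymorphic using () renaming (⊥ to ⊥ₚ)
open import Data.Product using (Σ; ∃; ∃-syntax; _×_; _,_)
open import Data.Sum using (_⊎_; inj₁; inj₂)
open import Data.Unit.Polymorphic using () renaming (⊤ to ⊤ₚ)
open import Function using (_∘_; _⇔_)
open import Level using (Level) renaming (suc to lsuc; _⊔_ to _⊔ˡ_)
open import Relation.Binary.Bundles using (Poset)
open import Relation.Binary.Definitions using (_Respects_)
open import Relation.Nullary using (¬_; contradiction)
open import Relation.Unary using (Pred)

private
  variable
    ℓ : Level

-- Zorn's lemma, as a proposition. Together with excluded middle it stands for
-- the ambient classical set theory; it is only ever used as a hypothesis.
Zorn : (a ℓ₁ ℓ₂ c : Level) → Set (lsuc (a ⊔ˡ ℓ₁ ⊔ˡ ℓ₂ ⊔ˡ c))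
Zorn a ℓ₁ ℓ₂ c = (P : Poset a ℓ₁ ℓ₂) → let open Poset P in
  ((C : Pred Carrier c) →
     (∀ {x y} → C x → C y → (x ≤ y) ⊎ (y ≤ x)) →
     ∃[ u ] (∀ {x} → C x → x ≤ u)) →
  ∃[ m ] (∀ {x} → m ≤ x → x ≈ m)

-- Groups carry a setoid equality, so a subset is a predicate respecting it.
record Subset (G : Group ℓ ℓ) : Set (lsuc ℓ) where
  open Group G
  field
    mem  : Pred Carrier ℓ
    resp : mem Respects _≈_

open Subset public

module _ {G : Group ℓ ℓ} where
  open Group G

  infix 4 _∈_ _⊆_ _≐_
  infixr 7 _∩_

  _∈_ : Carrier → Subset G → Set ℓ
  x ∈ A = mem A x

  _⊆_ : Subset G → Subset G → Set ℓ
  A ⊆ B = ∀ {x} → x ∈ A → x ∈ B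

  _≐_ : Subset G → Subset G → Set ℓ
  A ≐ B = (A ⊆ B) × (B ⊆ A)

  ∅ : Subset G
  ∅ = record { mem = λ _ → ⊥ₚ ; resp = λ _ () }

  full : Subset G
  full = record { mem = λ _ → ⊤ₚ ; resp = λ _ _ → _ }

  _∩_ : Subset G → Subset G → Subset G
  A ∩ B = record
    { mem  = λ x → x ∈ A × x ∈ B
    ; resp = λ x≈y (a , b) → resp A x≈y a , resp B x≈y b
    }

  ∁ : Subset G → Subset G
  ∁ A = record
    { mem  = λ x → ¬ (x ∈ A)
    ; resp = λ x≈y x∉A y∈A → x∉A (resp A (sym x≈y) y∈A)
    }

  -- x ⁻¹· A is { y : x ∙ y ∈ A }.
  infixr 8 _⁻¹·_
  _⁻¹·_ : Carrier → Subset G → Subset G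
  x ⁻¹· A = record
    { mem  = λ y → x ∙ y ∈ A
    ; resp = λ y≈z → resp A (∙-congˡ y≈z)
    }

record Filter (G : Group ℓ ℓ) : Set (lsuc ℓ) where
  infix 4 _∋_
  field
    _∋_    : Subset G → Set ℓ
    whole  : _∋_ full
    proper : ¬ (_∋_ ∅)
    upward : ∀ {A B} → A ⊆ B → _∋_ A → _∋_ B
    meet   : ∀ {A B} → _∋_ A → _∋_ B → _∋_ (A ∩ B)

open Filter public using (_∋_)

-- The points of βG.
record Ultrafilter (G : Group ℓ ℓ) : Set (lsuc ℓ) where
  field
    filter : Filter G
    ultra  : ∀ A → (filter ∋ A) ⊎ (filter ∋ ∁ A)

open Ultrafilter public using (filter)

module _ {G : Group ℓ ℓ} where
  open Group G

  infix 4 _∈ᵘ_ _≃_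
  infixl 7 _·_

  _∈ᵘ_ : Subset G → Ultrafilter G → Set ℓ
  A ∈ᵘ p = filter p ∋ A

  -- Equality of points of βG: ultrafilters with the same members.
  _≃_ : Ultrafilter G → Ultrafilter G → Set (lsuc ℓ)
  p ≃ q = ∀ A → (A ∈ᵘ p) ⇔ (A ∈ᵘ q)

  translates : Subset G → Ultrafilter G → Subset G
  translates A q = record
    { mem  = λ x → (x ⁻¹· A) ∈ᵘ q
    ; resp = λ x≈y → Filter.upward (filter q) (resp A (∙-congʳ x≈y))
    }

  _·_ : Ultrafilter G → Ultrafilter G → Ultrafilter G
  p · q = record
    { filter = record
      { _∋_    = λ A → translates A q ∈ᵘ p
      ; whole  = P.upward (λ _ → Q.upward (λ _ → _) Q.whole) P.whole
      ; proper = λ h → P.proper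
          (P.upward (λ e → contradiction (Q.upward (λ ()) e) Q.proper) h)
      ; upward = λ A⊆B → P.upward (Q.upward A⊆B)
      ; meet   = λ a b → P.upward
          (λ (a′ , b′) → Q.upward (λ z → z) (Q.meet a′ b′)) (P.meet a b)
      }
    ; ultra = λ A → case-ultra A (Ultrafilter.ultra p (translates A q))
    }
    where
    module P = Filter (filter p)
    module Q = Filter (filter q)

    flip-∁ : ∀ A {x} → x ∈ ∁ (translates A q) → x ∈ translates (∁ A) q
    flip-∁ A {x} h with Ultrafilter.ultra q (x ⁻¹· A)
    ... | inj₁ t = contradiction t h
    ... | inj₂ t = Q.upward (λ z → z) t

    case-ultra : ∀ A →
      (translates A q ∈ᵘ p) ⊎ (∁ (translates A q) ∈ᵘ p) →
      (translates A q ∈ᵘ p) ⊎ (translates (∁ A) q ∈ᵘ p)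
    case-ultra A (inj₁ t) = inj₁ t
    case-ultra A (inj₂ t) = inj₂ (P.upward (flip-∁ A) t)

  closure : Filter G → Pred (Ultrafilter G) (lsuc ℓ)
  closure 𝓕 p = ∀ V → 𝓕 ∋ V → V ∈ᵘ p

  -- The closure of a (proper) filter is non-empty, so closure under the
  -- operation is all there is to ask.
  ClosureIsSubsemigroup : Filter G → Set (lsuc ℓ)
  ClosureIsSubsemigroup 𝓕 =
    ∀ p q → closure 𝓕 p → closure 𝓕 q → closure 𝓕 (p · q)

  record IsIdeal (𝓕 : Filter G) (I : Pred (Ultrafilter G) (lsuc ℓ)) : Set (lsuc ℓ) where
    field
      respects : I Respects _≃_
      nonempty : ∃[ p ] I p
      included : ∀ {p} → I p → closure 𝓕 p
      left     : ∀ {p q} → closure 𝓕 p → I q → I (p · q)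
      right    : ∀ {p q} → I p → closure 𝓕 q → I (p · q)

  -- "K is K(closure 𝓕)"; such a K is unique up to logical equivalence.
  record IsSmallestIdeal (𝓕 : Filter G) (K : Pred (Ultrafilter G) (lsuc ℓ)) : Set (lsuc (lsuc ℓ)) where
    field
      isIdeal  : IsIdeal 𝓕 K
      smallest : ∀ I → IsIdeal 𝓕 I → ∀ {p} → K p → I p

  PiecewiseSyndetic : Filter G → Subset G → Set (lsuc (lsuc ℓ))
  PiecewiseSyndetic 𝓕 A =
    Σ (Pred (Ultrafilter G) (lsuc ℓ)) λ K →
      IsSmallestIdeal 𝓕 K × (∃[ p ] (K p × A ∈ᵘ p))

  record IsSubgroup (H : Subset G) : Set ℓ where
    field
      ε-closed  : ε ∈ H
      ∙-closed  : ∀ {x y} → x ∈ H → y ∈ H → x ∙ y ∈ H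
      ⁻¹-closed : ∀ {x} → x ∈ H → x ⁻¹ ∈ H

record GroupHom (G₁ G₂ : Group ℓ ℓ) : Set ℓ where
  open GroupMorphisms (Group.rawGroup G₁) (Group.rawGroup G₂)
  field
    ⟦_⟧            : Group.Carrier G₁ → Group.Carrier G₂
    isHomomorphism : IsGroupHomomorphism ⟦_⟧

  open IsGroupHomomorphism isHomomorphism public

module _ {G₁ G₂ : Group ℓ ℓ} (φ : GroupHom G₁ G₂) where
  open GroupHom φ
  private
    module G₁ = Group G₁
    module G₂ = Group G₂

  preimage : Subset G₂ → Subset G₁
  preimage B = record
    { mem  = λ x → ⟦ x ⟧ ∈ B
    ; resp = resp B ∘ ⟦⟧-cong
    }

  image : Subset G₁ → Subset G₂
  image A = record
    { mem  = λ y → ∃[ x ] (x ∈ A × ⟦ x ⟧ G₂.≈ y)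
    ; resp = λ y≈z (x , x∈A , φx≈y) → x , x∈A , G₂.trans φx≈y y≈z
    }

  Good : Filter G₁ → Filter G₂ → Set (lsuc ℓ)
  Good 𝓕 𝓖 = ∀ F → 𝓕 ∋ F → ∃[ B ] (𝓖 ∋ B × F ≐ preimage B)

{-# OPTIONS --safe #-}

-- Closed subsets of βG are the closures of filters on G, so Zorn's lemma for
-- filters gives ultrafilters, minimal closed left ideals and idempotents.
--
-- Every point p of K(closure 𝓕) satisfies p ∈ closure 𝓕 · r · p for all r in
-- closure 𝓕; if a subgroup H belongs to p, this forces every r in closure 𝓕
-- to contain a left coset of H.  On the other side, let q ∈ K(closure 𝓖)
-- contain φ(G₁).  The closed semigroup of all points of closure 𝓖 · q that
-- contain φ(G₁) has an idempotent e, which lies in K(closure 𝓖).  As e contains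
-- φ(G₁), it lifts along φ to an ultrafilter, and goodness puts the lift in
-- closure 𝓕.  The lift contains a left coset of H₁, so e contains a left coset
-- of φ(H₁), and an idempotent containing a left coset of a subgroup contains
-- the subgroup itself.
module Submission where

open import Defs
open import Algebra.Bundles using (Group)
import Algebra.Properties.Group as GroupProperties
open import Axiom.ExcludedMiddle using (ExcludedMiddle)
open import Data.Empty.Polymorphic using () renaming (⊥-elim to ⊥ₚ-elim)
open import Data.Product using (∃; ∃-syntax; _×_; _,_; proj₁; proj₂)
open import Data.Sum using (_⊎_; inj₁; inj₂)
open import Data.Unit.Polymorphic using (⊤)
open import Function using (id; _∘_; mk⇔; Equivalence)
open import Level using (Level) renaming (suc to lsuc)
open import Relation.Binary.Bundles using (Poset)
open import Relation.Nullary using (¬_; yes; no; contradiction)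
open import Relation.Nullary.Decidable using (True; toWitness; fromWitness; decidable-stable)
open import Relation.Unary using (Pred)

private
  variable
    a ℓ : Level

-- Equality of ultrafilters and the operation on βG.

module _ {G : Group ℓ ℓ} where
  open Group G

  infix 4 _≼_
  _≼_ : Filter G → Filter G → Set (lsuc ℓ)
  𝓗 ≼ 𝓗′ = ∀ A → 𝓗 ∋ A → 𝓗′ ∋ A

  ∁-∉ : (p : Ultrafilter G) → ∀ {A} → A ∈ᵘ p → ¬ (∁ A ∈ᵘ p)
  ∁-∉ p a c = P.proper (P.upward (λ (x , y) → contradiction x y) (P.meet a c))
    where module P = Filter (filter p)

  ∉-∁ : (p : Ultrafilter G) → ∀ {A} → ¬ (A ∈ᵘ p) → ∁ A ∈ᵘ p
  ∉-∁ p {A} A∉p with Ultrafilter.ultra p A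
  ... | inj₁ A∈p  = contradiction A∈p A∉p
  ... | inj₂ ∁A∈p = ∁A∈p

  -- Ultrafilters are maximal, so every later equality is proved by a single inclusion.
  ≼⇒≃ : (p q : Ultrafilter G) → filter p ≼ filter q → p ≃ q
  ≼⇒≃ p q p≼q A = mk⇔ (p≼q A) back
    where
    back : A ∈ᵘ q → A ∈ᵘ p
    back A∈q with Ultrafilter.ultra p A
    ... | inj₁ A∈p  = A∈p
    ... | inj₂ ∁A∈p = contradiction (p≼q _ ∁A∈p) (∁-∉ q A∈q)

  ≃⇒≼ : (p q : Ultrafilter G) → p ≃ q → filter p ≼ filter q
  ≃⇒≼ p q p≃q A = Equivalence.to (p≃q A)

  ≃-refl : (p : Ultrafilter G) → p ≃ p
  ≃-refl p = ≼⇒≃ p p λ _ → id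

  ≃-sym : (p q : Ultrafilter G) → p ≃ q → q ≃ p
  ≃-sym p q p≃q A = mk⇔ (Equivalence.from (p≃q A)) (Equivalence.to (p≃q A))

  ≃-trans : (p q r : Ultrafilter G) → p ≃ q → q ≃ r → p ≃ r
  ≃-trans p q r p≃q q≃r = ≼⇒≃ p r λ A → ≃⇒≼ q r q≃r A ∘ ≃⇒≼ p q p≃q A

  ·-congˡ : (p q r : Ultrafilter G) → q ≃ r → p · q ≃ p · r
  ·-congˡ p q r q≃r = ≼⇒≃ (p · q) (p · r)
    λ A → Filter.upward (filter p) (≃⇒≼ q r q≃r _)

  ·-congʳ : (p q r : Ultrafilter G) → q ≃ r → q · p ≃ r · p
  ·-congʳ p q r q≃r = ≼⇒≃ (q · p) (r · p) λ A → ≃⇒≼ q r q≃r _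

  ·-assoc : (p q r : Ultrafilter G) → (p · q) · r ≃ p · (q · r)
  ·-assoc p q r = ≼⇒≃ ((p · q) · r) (p · (q · r)) λ A →
    Filter.upward (filter p) (Filter.upward (filter q)
      (Filter.upward (filter r) (resp A (assoc _ _ _))))

  closure-resp : (𝓗 : Filter G) (p q : Ultrafilter G) →
    p ≃ q → closure 𝓗 p → closure 𝓗 q
  closure-resp 𝓗 p q p≃q p∈ V V∈ = ≃⇒≼ p q p≃q V (p∈ V V∈)

  -- A relation rather than a construction, so that properties can be checked on unions without
  -- looking at how `chainUnion` is built.
  IsUnion : {I : Set a} → (I → Filter G) → Filter G → Set _
  IsUnion 𝓗 𝓤 =
    (∀ i → 𝓗 i ≼ 𝓤) × (∀ A → 𝓤 ∋ A → ∃[ i ] 𝓗 i ∋ A)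

  closure-⋃ : {I : Set a} (𝓗 : I → Filter G) (𝓤 : Filter G) →
    IsUnion 𝓗 𝓤 → ∀ p → (∀ i → closure (𝓗 i) p) → closure 𝓤 p
  closure-⋃ 𝓗 𝓤 (_ , cover) p p∈ V V∈ = let i , V∈ᵢ = cover V V∈ in p∈ i V V∈ᵢ

  LeftIdeal : Filter G → Filter G → Set (lsuc ℓ)
  LeftIdeal 𝓕 𝓗 = ∀ p q → closure 𝓕 p → closure 𝓗 q → closure 𝓗 (p · q)

  _·cl_ : Filter G → Ultrafilter G → Pred (Ultrafilter G) (lsuc ℓ)
  (𝓗 ·cl v) p = ∃[ r ] (closure 𝓗 r × p ≃ r · v)

-- Subgroups and their images.

module _ {G : Group ℓ ℓ} {H : Subset G} (isSubgroup : IsSubgroup H) where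
  open Group G
  open GroupProperties G using (x≈z//y; y≈x\\z)
  open IsSubgroup isSubgroup

  cancelʳ-∈ : ∀ {x y} → x ∙ y ∈ H → y ∈ H → x ∈ H
  cancelʳ-∈ xy∈H y∈H =
    resp H (sym (x≈z//y _ _ _ refl)) (∙-closed xy∈H (⁻¹-closed y∈H))

  cancelˡ-∈ : ∀ {x y} → x ∙ y ∈ H → x ∈ H → y ∈ H
  cancelˡ-∈ xy∈H x∈H =
    resp H (sym (y≈x\\z _ _ _ refl)) (∙-closed (⁻¹-closed x∈H) xy∈H)

  subgroup-· : (p q : Ultrafilter G) → H ∈ᵘ p → H ∈ᵘ q → H ∈ᵘ (p · q)
  subgroup-· p q H∈p H∈q = Filter.upward (filter p)
    (λ x∈H → Filter.upward (filter q) (∙-closed x∈H) H∈q) H∈p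

module _ {G₁ G₂ : Group ℓ ℓ} (φ : GroupHom G₁ G₂) where
  open GroupHom φ
  private
    module G₂ = Group G₂

  image-isSubgroup : ∀ {H} → IsSubgroup H → IsSubgroup (image φ H)
  image-isSubgroup isSubgroup = record
    { ε-closed  = _ , ε-closed , ε-homo
    ; ∙-closed  = λ (x , x∈H , φx≈) (y , y∈H , φy≈) →
        _ , ∙-closed x∈H y∈H , G₂.trans (homo x y) (G₂.∙-cong φx≈ φy≈)
    ; ⁻¹-closed = λ (x , x∈H , φx≈) →
        _ , ⁻¹-closed x∈H , G₂.trans (⁻¹-homo x) (G₂.⁻¹-cong φx≈)
    }
    where open IsSubgroup isSubgroup

full-isSubgroup : {G : Group ℓ ℓ} → IsSubgroup (full {G = G})
full-isSubgroup = record
  { ε-closed = _ ; ∙-closed = λ _ _ → _ ; ⁻¹-closed = λ _ → _ }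

module Classical
  (em : ∀ {a : Level} → ExcludedMiddle a)
  (zorn : ∀ {a ℓ₁ ℓ₂ c : Level} → Zorn a ℓ₁ ℓ₂ c) where

  -- Excluded middle makes propositions of any level ℓ-small; filters need this
  -- because their membership predicate is valued in Set ℓ.
  record Small (ℓ : Level) (X : Set a) : Set ℓ where
    constructor lift-small
    field holds : True (em {P = X})

  small : {X : Set a} → X → Small ℓ X
  small x = lift-small (fromWitness x)

  unsmall : {X : Set a} → Small ℓ X → X
  unsmall s = toWitness (Small.holds s)

  byContradiction : {X : Set a} → ¬ ¬ X → X
  byContradiction = decidable-stable em

  -- Filters from bases, from closed sets and from chains; maximal filters.

  module _ {G : Group ℓ ℓ} where
    open Group G using (assoc; sym)

    inhabited : (p : Ultrafilter G) → ∀ {A} → A ∈ᵘ p → ∃[ x ] x ∈ A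
    inhabited p A∈p = byContradiction λ none →
      P.proper (P.upward (λ x∈A → contradiction (_ , x∈A) none) A∈p)
      where module P = Filter (filter p)

    generated : {I : Set (lsuc ℓ)} (B : I → Subset G) → I →
      (∀ i j → ∃[ k ] B k ⊆ B i ∩ B j) →
      (∀ i → ¬ (B i ⊆ ∅)) → Filter G
    generated B i₀ directed nonempty = record
      { _∋_    = λ A → Small ℓ (∃[ i ] B i ⊆ A)
      ; whole  = small (i₀ , λ _ → _)
      ; proper = λ s → let i , B⊆∅ = unsmall s in nonempty i B⊆∅
      ; upward = λ A⊆A′ s → let i , B⊆A = unsmall s in
          small (i , λ x∈B → A⊆A′ (B⊆A x∈B))
      ; meet   = λ s t →
          let i , Bᵢ⊆ = unsmall s
              j , Bⱼ⊆ = unsmall t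
              k , Bₖ⊆ = directed i j
          in small (k , λ x∈B → Bᵢ⊆ (proj₁ (Bₖ⊆ x∈B)) , Bⱼ⊆ (proj₂ (Bₖ⊆ x∈B)))
      }

    -- The intersection of the points of `X`; its closure is the topological closure of `X` in βG.
    filterOf : (X : Pred (Ultrafilter G) (lsuc ℓ)) → ∃ X → Filter G
    filterOf X (p , p∈X) = record
      { _∋_    = λ A → Small ℓ (∀ q → X q → A ∈ᵘ q)
      ; whole  = small λ q _ → Filter.whole (filter q)
      ; proper = λ s → Filter.proper (filter p) (unsmall s p p∈X)
      ; upward = λ A⊆B s → small λ q q∈X →
          Filter.upward (filter q) A⊆B (unsmall s q q∈X)
      ; meet   = λ s t → small λ q q∈X →
          Filter.meet (filter q) (unsmall s q q∈X) (unsmall t q q∈X)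
      }

    filterOf-⊇ : ∀ X (x : ∃ X) p → X p → closure (filterOf X x) p
    filterOf-⊇ X x p p∈X V V∈ = unsmall V∈ p p∈X

    Closed : (X : Pred (Ultrafilter G) (lsuc ℓ)) → Set (lsuc ℓ)
    Closed X = ∀ p → (∀ A → (∀ q → X q → A ∈ᵘ q) → A ∈ᵘ p) → X p

    filterOf-⊆ : ∀ X (x : ∃ X) → Closed X → ∀ p → closure (filterOf X x) p → X p
    filterOf-⊆ X x closed p p∈ = closed p λ A A∈ → p∈ A (small A∈)

    filterOf-subsemigroup : ∀ X (x : ∃ X) → Closed X →
      (∀ p q → X p → X q → X (p · q)) → ClosureIsSubsemigroup (filterOf X x)
    filterOf-subsemigroup X x closed X-· p q p∈ q∈ = filterOf-⊇ X x (p · q)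
      (X-· p q (filterOf-⊆ X x closed p p∈) (filterOf-⊆ X x closed q q∈))

    chainUnion : {I : Set a} (𝓗 : I → Filter G) → I →
      (∀ i j → (𝓗 i ≼ 𝓗 j) ⊎ (𝓗 j ≼ 𝓗 i)) → Filter G
    chainUnion {I = I} 𝓗 i₀ total = record
      { _∋_    = λ A → Small ℓ (∃[ i ] 𝓗 i ∋ A)
      ; whole  = small (i₀ , Filter.whole (𝓗 i₀))
      ; proper = λ s → let i , ∅∈ = unsmall s in Filter.proper (𝓗 i) ∅∈
      ; upward = λ A⊆B s → let i , A∈ = unsmall s in
          small (i , Filter.upward (𝓗 i) A⊆B A∈)
      ; meet   = λ s t → small (meet′ (unsmall s) (unsmall t))
      }
      where
      meet′ : ∀ {A B} → ∃[ i ] 𝓗 i ∋ A → ∃[ i ] 𝓗 i ∋ B → ∃[ i ] 𝓗 i ∋ (A ∩ B)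
      meet′ (i , A∈) (j , B∈) with total i j
      ... | inj₁ i≼j = j , Filter.meet (𝓗 j) (i≼j _ A∈) B∈
      ... | inj₂ j≼i = i , Filter.meet (𝓗 i) A∈ (j≼i _ B∈)

    -- Larger filters have smaller closures, so a maximal filter stands for a minimal closed set.
    -- This replaces the usual compactness argument on descending chains.
    maximalFilter : (P : Pred (Filter G) (lsuc ℓ)) →
      (∀ {I : Set (lsuc ℓ)} (𝓗 : I → Filter G) (𝓤 : Filter G) →
        IsUnion 𝓗 𝓤 → (∀ i → P (𝓗 i)) → P 𝓤) →
      (𝓑 : Filter G) → P 𝓑 →
      ∃[ 𝓜 ] (P 𝓜 × 𝓑 ≼ 𝓜 × (∀ 𝓗 → P 𝓗 → 𝓜 ≼ 𝓗 → 𝓗 ≼ 𝓜))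
    maximalFilter P P-⋃ 𝓑 P𝓑 =
      let (𝓜 , P𝓜 , 𝓑≼𝓜) , max = zorn {c = lsuc ℓ} poset bound
      in 𝓜 , P𝓜 , 𝓑≼𝓜 , λ 𝓗 P𝓗 𝓜≼𝓗 →
        proj₁ (max {𝓗 , P𝓗 , λ A A∈ → 𝓜≼𝓗 A (𝓑≼𝓜 A A∈)} 𝓜≼𝓗)
      where
      E : Set (lsuc ℓ)
      E = ∃[ 𝓗 ] (P 𝓗 × 𝓑 ≼ 𝓗)

      poset : Poset (lsuc ℓ) (lsuc ℓ) (lsuc ℓ)
      poset = record
        { Carrier = E
        ; _≈_ = λ (𝓗 , _) (𝓗′ , _) → (𝓗 ≼ 𝓗′) × (𝓗′ ≼ 𝓗)
        ; _≤_ = λ (𝓗 , _) (𝓗′ , _) → 𝓗 ≼ 𝓗′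
        ; isPartialOrder = record
          { isPreorder = record
            { isEquivalence = record
              { refl  = (λ _ → id) , (λ _ → id)
              ; sym   = λ (f , g) → g , f
              ; trans = λ (f , g) (f′ , g′) →
                  (λ A → f′ A ∘ f A) , (λ A → g A ∘ g′ A)
              }
            ; reflexive = proj₁
            ; trans = λ f g A → g A ∘ f A
            }
          ; antisym = _,_
          }
        }

      bound : (C : Pred E (lsuc ℓ)) →
        (∀ {x y} → C x → C y → (proj₁ x ≼ proj₁ y) ⊎ (proj₁ y ≼ proj₁ x)) →
        ∃[ u ] (∀ {x} → C x → proj₁ x ≼ proj₁ u)
      bound C chain with em {P = ∃ C}
      -- The union of the empty chain is not a filter, so `𝓑` itself serves as bound.
      ... | no  empty = (𝓑 , P𝓑 , λ _ → id) , λ c → contradiction (_ , c) empty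
      ... | yes i₀    = (𝓤 , P𝓤 , 𝓑≼𝓤) , λ c A A∈ → small ((_ , c) , A∈)
        where
        𝓗 : ∃ C → Filter G
        𝓗 ((𝓗ᵢ , _) , _) = 𝓗ᵢ
        𝓤 : Filter G
        𝓤 = chainUnion 𝓗 i₀ λ (_ , c) (_ , d) → chain c d
        P𝓤 : P 𝓤
        P𝓤 = P-⋃ 𝓗 𝓤 ((λ i A A∈ → small (i , A∈)) , λ A → unsmall)
          λ ((_ , P𝓗ᵢ , _) , _) → P𝓗ᵢ
        𝓑≼𝓤 : 𝓑 ≼ 𝓤
        𝓑≼𝓤 A A∈ = small (i₀ , proj₂ (proj₂ (proj₁ i₀)) A A∈)

    -- A maximal filter lacking `A` can be enlarged by `∁ A`, and maximality then puts `∁ A` in it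
    -- already.
    ultrafilterLemma : (𝓗 : Filter G) → ∃[ p ] closure 𝓗 p
    ultrafilterLemma 𝓗 with maximalFilter (λ _ → ⊤) (λ _ _ _ _ → _) 𝓗 _
    ... | 𝓜 , _ , 𝓗≼𝓜 , max = record { filter = 𝓜 ; ultra = ultra } , 𝓗≼𝓜
      where
      open Filter 𝓜 using (whole; upward; meet)

      ultra : ∀ A → (𝓜 ∋ A) ⊎ (𝓜 ∋ ∁ A)
      ultra A with em {P = 𝓜 ∋ A}
      ... | yes A∈ = inj₁ A∈
      ... | no  A∉ = inj₂ (max 𝓜′ _
              (λ B B∈ → small ((B , B∈) , proj₁)) (∁ A)
              (small ((full , whole) , proj₂)))
        where
        𝓜′ : Filter G
        𝓜′ = generated {I = ∃[ B ] 𝓜 ∋ B} (λ (B , _) → B ∩ ∁ A) (full , whole)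
          (λ (B , B∈) (C , C∈) → (B ∩ C , meet B∈ C∈) ,
            λ ((x∈B , x∈C) , x∉A) → (x∈B , x∉A) , (x∈C , x∉A))
          -- If `B ∩ ∁ A` were empty, `B` would lie in `A` and force `A` into `𝓜`.
          (λ (B , B∈) B∩∁A⊆∅ → A∉ (upward
            (λ x∈B → byContradiction λ x∉A → ⊥ₚ-elim (B∩∁A⊆∅ (x∈B , x∉A))) B∈))

    -- Closed left translates, idempotents and minimal left ideals.

    -- The image of a compact set under the continuous map sending `r` to `r · v`. For a limit point
    -- `s`, the conditions that `r` lie in `closure 𝓗` and `r · v` equal `s` generate a proper
    -- filter `𝓓`, and any ultrafilter above it solves both.
    ·cl-closed : (𝓗 : Filter G) (v : Ultrafilter G) → Closed (𝓗 ·cl v)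
    ·cl-closed 𝓗 v s s∈ =
      r , (λ V V∈ → r∈ V (small ((V , full , V∈ , S.whole) , proj₁))) ,
      ≼⇒≃ s (r · v) λ B B∈ →
        r∈ (translates B v) (small ((full , B , Filter.whole 𝓗 , B∈) , proj₂))
      where
      module S = Filter (filter s)
      module V = Filter (filter v)
      I : Set (lsuc ℓ)
      I = ∃[ V ] ∃[ B ] (𝓗 ∋ V × B ∈ᵘ s)
      -- Were the intersection empty, `∁ B` would belong to every point of `𝓗 ·cl v`, hence to `s`.
      nonempty : ∀ ((V , B , _) : I) → ¬ (V ∩ translates B v ⊆ ∅)
      nonempty (V , B , V∈ , B∈) empty = ∁-∉ s B∈ (s∈ (∁ B) λ p (r , r∈ , p≃) →
        ≃⇒≼ (r · v) p (≃-sym p (r · v) p≃) (∁ B)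
          (∉-∁ (r · v) {B} λ B∈rv → Filter.proper (filter r)
            (Filter.upward (filter r) empty
              (Filter.meet (filter r) (r∈ V V∈) B∈rv))))
      𝓓 : Filter G
      𝓓 = generated (λ (V , B , _) → V ∩ translates B v)
        (full , full , Filter.whole 𝓗 , S.whole)
        (λ (V , B , V∈ , B∈) (V′ , B′ , V′∈ , B′∈) →
          (V ∩ V′ , B ∩ B′ , Filter.meet 𝓗 V∈ V′∈ , S.meet B∈ B′∈) ,
          λ ((x∈V , x∈V′) , t) → (x∈V , V.upward proj₁ t) , (x∈V′ , V.upward proj₂ t))
        nonempty
      r : Ultrafilter G
      r = proj₁ (ultrafilterLemma 𝓓)
      r∈ : closure 𝓓 r
      r∈ = proj₂ (ultrafilterLemma 𝓓)

    -- The Ellis-Numakura argument: any point `u` of a minimal closed subsemigroup is idempotent,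
    -- since `𝓐 ·cl u` and then the stabiliser `Y` of `u` are closed subsemigroups and must contain
    -- `u`.
    ellis : (𝓗 : Filter G) → ClosureIsSubsemigroup 𝓗 →
      ∃[ e ] (closure 𝓗 e × e · e ≃ e)
    ellis 𝓗 𝓗-semi
      with maximalFilter ClosureIsSubsemigroup
        (λ 𝓗ᵢ 𝓤 U semi p q p∈ q∈ → closure-⋃ 𝓗ᵢ 𝓤 U (p · q) λ i → semi i p q
          (λ V V∈ → p∈ V (proj₁ U i V V∈)) (λ V V∈ → q∈ V (proj₁ U i V V∈)))
        𝓗 𝓗-semi
    ... | 𝓐 , semi , 𝓗≼𝓐 , max with ultrafilterLemma 𝓐
    ... | u , u∈ = u , (λ V V∈ → u∈ V (𝓗≼𝓐 V V∈)) , proj₂ u∈Y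
      where
      -- `filterOf X x` lies above `𝓐`, so by maximality the two have the same members.
      minimal : ∀ X (x : ∃ X) → Closed X → (∀ p q → X p → X q → X (p · q)) →
        (∀ p → X p → closure 𝓐 p) → X u
      minimal X x closed X-· X⊆ = filterOf-⊆ X x closed u λ V V∈ → u∈ V
        (max (filterOf X x) (filterOf-subsemigroup X x closed X-·)
          (λ A A∈ → small λ q q∈X → X⊆ q q∈X A A∈) V V∈)

      Au⊆ : ∀ p → (𝓐 ·cl u) p → closure 𝓐 p
      Au⊆ p (r , r∈ , p≃) =
        closure-resp 𝓐 (r · u) p (≃-sym p (r · u) p≃) (semi r u r∈ u∈)

      u∈Au : (𝓐 ·cl u) u
      u∈Au = minimal (𝓐 ·cl u) (u · u , u , u∈ , ≃-refl (u · u)) (·cl-closed 𝓐 u)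
        (λ p q p∈ (r , r∈ , q≃) → p · r , semi p r (Au⊆ p p∈) r∈ ,
          ≃-trans (p · q) (p · (r · u)) ((p · r) · u) (·-congˡ p q (r · u) q≃)
            (≃-sym ((p · r) · u) (p · (r · u)) (·-assoc p r u)))
        Au⊆

      Y : Pred (Ultrafilter G) (lsuc ℓ)
      Y w = closure 𝓐 w × w · u ≃ u

      u∈Y : Y u
      u∈Y = minimal Y
        (let w , w∈ , u≃ = u∈Au in w , w∈ , ≃-sym u (w · u) u≃)
        (λ p p∈ → (λ V V∈ → p∈ V λ q (q∈ , _) → q∈ V V∈) ,
          ≃-sym u (p · u) (≼⇒≃ u (p · u) λ B B∈ → p∈ (translates B u)
            λ q (_ , qu≃u) → ≃⇒≼ u (q · u) (≃-sym (q · u) u qu≃u) B B∈))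
        (λ p q (p∈ , pu≃u) (q∈ , qu≃u) → semi p q p∈ q∈ ,
          ≃-trans ((p · q) · u) (p · (q · u)) u (·-assoc p q u)
            (≃-trans (p · (q · u)) (p · u) u (·-congˡ p (q · u) u qu≃u) pu≃u))
        (λ _ → proj₁)

    -- The points lying in a minimal left ideal of closure 𝓕.
    Recurrent : Filter G → Pred (Ultrafilter G) (lsuc ℓ)
    Recurrent 𝓕 u = closure 𝓕 u × (∀ r → closure 𝓕 r → (𝓕 ·cl (r · u)) u)

    -- Any point `u` of a minimal closed left ideal works: `𝓕 ·cl (r · u)` is a closed left ideal
    -- inside it, so it contains `u`.
    recurrent-inhabited : (𝓕 : Filter G) → ClosureIsSubsemigroup 𝓕 → ∃ (Recurrent 𝓕)
    recurrent-inhabited 𝓕 𝓕-semi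
      with maximalFilter (LeftIdeal 𝓕)
        (λ 𝓗ᵢ 𝓤 U left p q p∈ q∈ → closure-⋃ 𝓗ᵢ 𝓤 U (p · q) λ i → left i p q
          p∈ (λ V V∈ → q∈ V (proj₁ U i V V∈)))
        𝓕 𝓕-semi
    ... | 𝓛 , left , 𝓕≼𝓛 , max with ultrafilterLemma 𝓛
    ... | u , u∈ = u , (λ V V∈ → u∈ V (𝓕≼𝓛 V V∈)) , recurs
      where
      recurs : ∀ r → closure 𝓕 r → (𝓕 ·cl (r · u)) u
      recurs r r∈ = filterOf-⊆ X x closed u λ V V∈ → u∈ V
        (max (filterOf X x) X-left X⊆ V V∈)
        where
        X : Pred (Ultrafilter G) (lsuc ℓ)
        X = 𝓕 ·cl (r · u)
        x : ∃ X
        x = r · (r · u) , r , r∈ , ≃-refl (r · (r · u))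
        closed : Closed X
        closed = ·cl-closed 𝓕 (r · u)
        X⊆ : 𝓛 ≼ filterOf X x
        X⊆ A A∈ = small λ q (s , s∈ , q≃) →
          ≃⇒≼ (s · (r · u)) q (≃-sym q (s · (r · u)) q≃) A
            (left s (r · u) s∈ (left r u r∈ u∈) A A∈)
        X-left : LeftIdeal 𝓕 (filterOf X x)
        X-left p q p∈ q∈ = let s , s∈ , q≃ = filterOf-⊆ X x closed q q∈ in
          filterOf-⊇ X x (p · q) (p · s , 𝓕-semi p s p∈ s∈ ,
            ≃-trans (p · q) (p · (s · (r · u))) ((p · s) · (r · u))
              (·-congˡ p q (s · (r · u)) q≃)
              (≃-sym ((p · s) · (r · u)) (p · (s · (r · u))) (·-assoc p s (r · u))))

    -- Being an ideal, the set of recurrent points contains the smallest ideal.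
    recurrent-isIdeal : (𝓕 : Filter G) → ClosureIsSubsemigroup 𝓕 →
      IsIdeal 𝓕 (Recurrent 𝓕)
    recurrent-isIdeal 𝓕 semi = record
      { respects = λ {p} {q} p≃q (p∈ , rec) → closure-resp 𝓕 p q p≃q p∈ , λ r r∈ →
          let s , s∈ , p≃ = rec r r∈ in s , s∈ ,
            ≃-trans q p (s · (r · q)) (≃-sym p q p≃q)
              (≃-trans p (s · (r · p)) (s · (r · q)) p≃
                (·-congˡ s (r · p) (r · q) (·-congˡ r p q p≃q)))
      ; nonempty = recurrent-inhabited 𝓕 semi
      ; included = proj₁
      -- Recurrence of `u` is used at `r · v`, then multiplied by `v` on the left.
      ; left     = λ {v} {u} v∈ (u∈ , rec) → semi v u v∈ u∈ , λ r r∈ →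
          let s , s∈ , u≃ = rec (r · v) (semi r v r∈ v∈) in
          v · s , semi v s v∈ s∈ ,
            ≃-trans (v · u) (v · (s · ((r · v) · u))) ((v · s) · (r · (v · u)))
              (·-congˡ v u (s · ((r · v) · u)) u≃)
              (≃-trans (v · (s · ((r · v) · u))) ((v · s) · ((r · v) · u))
                  ((v · s) · (r · (v · u)))
                (≃-sym ((v · s) · ((r · v) · u)) (v · (s · ((r · v) · u)))
                  (·-assoc v s ((r · v) · u)))
                (·-congˡ (v · s) ((r · v) · u) (r · (v · u)) (·-assoc r v u)))
      ; right    = λ {u} {v} (u∈ , rec) v∈ → semi u v u∈ v∈ , λ r r∈ →
          let s , s∈ , u≃ = rec r r∈ in
          s , s∈ ,
            ≃-trans (u · v) ((s · (r · u)) · v) (s · (r · (u · v)))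
              (·-congʳ v u (s · (r · u)) u≃)
              (≃-trans ((s · (r · u)) · v) (s · ((r · u) · v)) (s · (r · (u · v)))
                (·-assoc s (r · u) v)
                (·-congˡ s ((r · u) · v) (r · (u · v)) (·-assoc r u v)))
      }

    -- Cosets of subgroups as members of ultrafilters.

    module _ {H : Subset G} (isSubgroup : IsSubgroup H) where

      coset-∈ : (𝓕 : Filter G) → ClosureIsSubsemigroup 𝓕 → PiecewiseSyndetic 𝓕 H →
        ∀ r → closure 𝓕 r → ∃[ x ] (x ⁻¹· H) ∈ᵘ r
      coset-∈ 𝓕 semi (K , isK , p , p∈K , H∈p) r r∈ =
        let s , _ , p≃ = proj₂ (IsSmallestIdeal.smallest isK (Recurrent 𝓕)
              (recurrent-isIdeal 𝓕 semi) p∈K) r r∈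
            x , x⁻¹H∈rp = inhabited s (≃⇒≼ p (s · (r · p)) p≃ H H∈p)
        in x , Filter.upward (filter r)
          -- Since `H` belongs to `p`, the point `z` can be taken in `H` and cancelled, leaving
          -- `x ∙ y` in `H`.
          (λ {y} h → let z , xyz∈H , z∈H = inhabited p (Filter.meet (filter p) h H∈p)
            in cancelʳ-∈ isSubgroup (resp H (sym (assoc x y z)) xyz∈H) z∈H)
          x⁻¹H∈rp

      idempotent-∋ : (e : Ultrafilter G) → e · e ≃ e →
        ∀ {x} → (x ⁻¹· H) ∈ᵘ e → H ∈ᵘ e
      idempotent-∋ e ee≃e {x} h =
        -- Idempotency supplies `w` and `z` with `x ∙ w`, `x ∙ z` and `x ∙ (w ∙ z)` all in `H`;
        -- cancelling gives `z`, then `x`, in `H`, so the coset is `H`.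
        let w , t , xw∈H = inhabited e (E.meet (≃⇒≼ e (e · e) (≃-sym (e · e) e ee≃e) _ h) h)
            z , xwz∈H , xz∈H = inhabited e (E.meet t h)
            z∈H = cancelˡ-∈ isSubgroup (resp H (sym (assoc x w z)) xwz∈H) xw∈H
            x∈H = cancelʳ-∈ isSubgroup xz∈H z∈H
        in E.upward (λ xy∈H → cancelˡ-∈ isSubgroup xy∈H x∈H) h
        where module E = Filter (filter e)

    idempotent-in-ideal : (𝓖 : Filter G) → ClosureIsSubsemigroup 𝓖 →
      ∀ {K} → IsIdeal 𝓖 K → ∀ {N} → IsSubgroup N → ∀ {q} → K q → N ∈ᵘ q →
      ∃[ e ] (K e × N ∈ᵘ e × e · e ≃ e)
    idempotent-in-ideal 𝓖 semi {K} isIdeal {N} N-subgroup {q} q∈K N∈q =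
      let e , e∈ , ee≃e = ellis (filterOf X x) (filterOf-subsemigroup X x closed X-·)
          e∈𝓖q , N∈e = filterOf-⊆ X x closed e e∈
      in e , 𝓖q⊆K e e∈𝓖q , N∈e , ee≃e
      where
      open IsIdeal isIdeal
      X : Pred (Ultrafilter G) (lsuc ℓ)
      X p = (𝓖 ·cl q) p × N ∈ᵘ p
      x : ∃ X
      -- The point `q · q` is visibly in `𝓖 ·cl q`, and it contains `N` because `N` is a subgroup.
      x = q · q , (q , included q∈K , ≃-refl (q · q)) ,
        subgroup-· N-subgroup q q N∈q N∈q
      closed : Closed X
      closed p p∈ = ·cl-closed 𝓖 q p (λ A A∈ → p∈ A λ s (s∈ , _) → A∈ s s∈) ,
        p∈ N λ _ → proj₂
      𝓖q⊆K : ∀ p → (𝓖 ·cl q) p → K p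
      𝓖q⊆K p (r , r∈ , p≃) = respects {r · q} {p} (≃-sym p (r · q) p≃) (left r∈ q∈K)
      X-· : ∀ p s → X p → X s → X (p · s)
      X-· p s (p∈ , N∈p) ((r , r∈ , s≃) , N∈s) =
        (p · r , semi p r (included (𝓖q⊆K p p∈)) r∈ ,
          ≃-trans (p · s) (p · (r · q)) ((p · r) · q) (·-congˡ p s (r · q) s≃)
            (≃-sym ((p · r) · q) (p · (r · q)) (·-assoc p r q))) ,
        subgroup-· N-subgroup p s N∈p N∈s

  -- Lifting ultrafilters along the homomorphism.

  module _ {G₁ G₂ : Group ℓ ℓ} (φ : GroupHom G₁ G₂) where
    open GroupHom φ
    private
      module G₂ = Group G₂

    -- Every member of `q` meets the image of `φ`, so the preimages form a base of a proper filter.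
    lift-ultrafilter : (q : Ultrafilter G₂) → image φ full ∈ᵘ q →
      ∃[ p ] (∀ B → B ∈ᵘ q → preimage φ B ∈ᵘ p)
    lift-ultrafilter q N∈q =
      let p , p∈ = ultrafilterLemma (generated {I = ∃[ B ] B ∈ᵘ q}
            (λ (B , _) → preimage φ B) (full , Q.whole)
            (λ (B , B∈) (C , C∈) → (B ∩ C , Q.meet B∈ C∈) , id)
            (λ (B , B∈) empty → let y , y∈B , x , _ , φx≈y = inhabited q (Q.meet B∈ N∈q)
              in ⊥ₚ-elim (empty (resp B (G₂.sym φx≈y) y∈B))))
      in p , λ B B∈ → p∈ (preimage φ B) (small ((B , B∈) , id))
      where module Q = Filter (filter q)

    good-lift : ∀ 𝓕 𝓖 → Good φ 𝓕 𝓖 → ∀ p q → closure 𝓖 q →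
      (∀ B → B ∈ᵘ q → preimage φ B ∈ᵘ p) → closure 𝓕 p
    good-lift 𝓕 𝓖 good p q q∈ lifts F F∈ =
      let B , B∈ , _ , φ⁻¹B⊆F = good F F∈
      in Filter.upward (filter p) φ⁻¹B⊆F (lifts B (q∈ B B∈))

    -- Otherwise the complement of the image coset lifts to a member of `p`, which meets `x ⁻¹· H`
    -- at some `y`; but `φ` sends `x ∙ y` into `image φ H`.
    image-coset-∈ : ∀ H {x} p q → (∀ B → B ∈ᵘ q → preimage φ B ∈ᵘ p) →
      (x ⁻¹· H) ∈ᵘ p → (⟦ x ⟧ ⁻¹· image φ H) ∈ᵘ q
    image-coset-∈ H {x} p q lifts h = byContradiction λ h′ →
      let y , xy∈H , φxφy∉ = inhabited p
            (Filter.meet (filter p) h (lifts _ (∉-∁ q {⟦ x ⟧ ⁻¹· image φ H} h′)))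
      in φxφy∉ (_ , xy∈H , homo x y)

theorem4p4 : (∀ {a : Level} → ExcludedMiddle a) →
    (∀ {a ℓ₁ ℓ₂ c : Level} → Zorn a ℓ₁ ℓ₂ c) →
    ∀ {ℓ : Level} (G₁ G₂ : Group ℓ ℓ)
    (𝓕 : Filter G₁) (𝓖 : Filter G₂) →
    ClosureIsSubsemigroup 𝓕 →
    ClosureIsSubsemigroup 𝓖 →
    (φ : GroupHom G₁ G₂) →
    Good φ 𝓕 𝓖 →
    PiecewiseSyndetic 𝓖 (image φ full) →
    (H₁ : Subset G₁) → IsSubgroup H₁ →
    PiecewiseSyndetic 𝓕 H₁ →
    PiecewiseSyndetic 𝓖 (image φ H₁)
theorem4p4 em zorn G₁ G₂ 𝓕 𝓖 𝓕-semi 𝓖-semi φ good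
  (K , isK , q , q∈K , N∈q) H₁ H₁-subgroup H₁-pws =
  let open IsSmallestIdeal isK
      e , e∈K , N∈e , ee≃e = idempotent-in-ideal 𝓖 𝓖-semi isIdeal
        (image-isSubgroup φ full-isSubgroup) q∈K N∈q
      p , lifts = lift-ultrafilter φ e N∈e
      p∈𝓕 = good-lift φ 𝓕 𝓖 good p e (IsIdeal.included isIdeal e∈K) lifts
      x , x⁻¹H₁∈p = coset-∈ H₁-subgroup 𝓕 𝓕-semi H₁-pws p p∈𝓕
  -- The smallest ideal is the one given with `φ(G₁)`; the witness in it changes from `q` to `e`.
  in K , isK , e , e∈K , idempotent-∋ (image-isSubgroup φ H₁-subgroup) e ee≃e
       (image-coset-∈ φ H₁ p e lifts x⁻¹H₁∈p)
  where open Classical em zorn
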